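{- Let $n\ge 6$ and let $K_n^k$ be the $k$-th Cartesian power of the complete graph $K_n$, where $k\ge 1$. If $k\leq n+1$, then $\rho'(K_n^k)\leq k\,\rho'(K_n)$.
   Context: $G^k$ denotes the $k$-th Cartesian power of $G$: $G^1=G$ and $G^k=G\square G^{k-1}$, where $\square$ is the Cartesian product of graphs. An edge coloring of a graph is distinguishing if no automorphism other than the identity preserves it. $D'(G)$ is the least number of colors in a distinguishing edge coloring of $G$. When $D'(G)=2$ (this holds for $K_n$ with $n\ge 6$), the cost of edge-distinguishing $\rho'(G)$ is the minimum number of edges in the smaller color class over all distinguishing edge colorings of $G$ with two colors. -}

module Defs where

open import Data.Fin as Fin using (Fin; zero; suc)
open import Data.Fin.Properties as Fin using (*↔×)
open import Data.List using (List; length; filter; map; allFin; cartesianProduct)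
open import Data.Nat using (ℕ; zero; suc; _*_; _≤_; _⊓_; NonZero)
open import Data.Product using (Σ-syntax; _×_; _,_)
open import Data.Product.Function.NonDependent.Propositional using (_×-↔_)
open import Data.Sum using (_⊎_; inj₁; inj₂)
open import Function using (_↔_; _⇔_; Inverse; Equivalence)
open import Function.Construct.Composition using (_↔-∘_)
open import Function.Construct.Identity using (↔-id)
open import Function.Construct.Symmetry using (↔-sym)
open import Function.Properties.Inverse using (↔⇒↣)
open import Relation.Binary.Definitions
  using (Symmetric; Irreflexive; Decidable; DecidableEquality)
open import Relation.Binary.PropositionalEquality
  using (_≡_; _≢_; refl; sym; trans; ≢-sym)
open import Relation.Nullary using (Dec; yes; no)
open import Relation.Nullary.Decidable using (_×-dec_; _⊎-dec_; ¬?)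
open import Relation.Unary using (Pred)

-- A finite simple graph. The enumeration is used only to count edges, by
-- picking one of the two orientations of each edge, and to decide equality.
record Graph : Set₁ where
  infix 4 _~_ _~?_
  field
    V       : Set
    order   : ℕ
    enum    : V ↔ Fin order
    _~_     : V → V → Set
    _~?_    : Decidable _~_
    ~-sym   : Symmetric _~_
    ~-irrefl : Irreflexive _≡_ _~_

  index : V → Fin order
  index = Inverse.to enum

  vertices : List V
  vertices = map (Inverse.from enum) (allFin order)

  _≟_ : DecidableEquality V
  _≟_ = Fin.inj⇒≟ (↔⇒↣ enum)

open Graph public using (V)

K : ℕ → Graph
K n = record
  { V        = Fin n
  ; order    = n
  ; enum     = ↔-id (Fin n)
  ; _~_      = _≢_
  ; _~?_     = λ u v → ¬? (u Fin.≟ v)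
  ; ~-sym    = ≢-sym
  ; ~-irrefl = λ u≡v u≢v → u≢v u≡v
  }

infixr 7 _□_
infixr 8 _^_

_□_ : Graph → Graph → Graph
G □ H = record
  { V        = G.V × H.V
  ; order    = G.order * H.order
  ; enum     = ↔-sym *↔× ↔-∘ (G.enum ×-↔ H.enum)
  ; _~_      = λ (g , h) (g′ , h′) → (g ≡ g′ × h H.~ h′) ⊎ (g G.~ g′ × h ≡ h′)
  ; _~?_     = λ (g , h) (g′ , h′) →
                 ((g G.≟ g′) ×-dec (h H.~? h′)) ⊎-dec ((g G.~? g′) ×-dec (h H.≟ h′))
  ; ~-sym    = λ where
      (inj₁ (p , q)) → inj₁ (sym p , H.~-sym q)
      (inj₂ (p , q)) → inj₂ (G.~-sym p , sym q)
  ; ~-irrefl = λ where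
      refl (inj₁ (_ , q)) → H.~-irrefl refl q
      refl (inj₂ (p , _)) → G.~-irrefl refl p
  }
  where
    module G = Graph G
    module H = Graph H

_^_ : Graph → (k : ℕ) .{{_ : NonZero k}} → Graph
G ^ suc zero    = G
G ^ suc (suc k) = G □ G ^ suc k

module _ (G : Graph) where
  open Graph G using (_~_; _~?_; ~-sym; index; vertices)

  record Automorphism : Set where
    field
      perm : V G ↔ V G
      adj  : ∀ {u v} → u ~ v ⇔ Inverse.to perm u ~ Inverse.to perm v

    apply : V G → V G
    apply = Inverse.to perm

  -- A colouring of the undirected edges with colours from Fin r. Applied
  -- twice, unoriented also says that the colour of an edge does not depend
  -- on the proof of adjacency.
  record EdgeColouring (r : ℕ) : Set where
    field
      colour     : ∀ {u v} → u ~ v → Fin r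
      unoriented : ∀ {u v} (p : u ~ v) (q : v ~ u) → colour p ≡ colour q

  module _ {r : ℕ} (c : EdgeColouring r) where
    open EdgeColouring c

    Preserves : Automorphism → Set
    Preserves φ = ∀ {u v} (p : u ~ v) → colour (Equivalence.to adj p) ≡ colour p
      where open Automorphism φ using (adj)

    Distinguishing : Set
    Distinguishing = ∀ φ → Preserves φ → ∀ v → Automorphism.apply φ v ≡ v

    -- (u , v) represents an edge of colour i when index u < index v; this
    -- selects exactly one orientation of every such edge.
    Represents : Fin r → Pred (V G × V G) _
    Represents i (u , v) = index u Fin.< index v × Σ[ p ∈ u ~ v ] colour p ≡ i

    represents? : ∀ i e → Dec (Represents i e)
    represents? i (u , v) = (index u Fin.<? index v) ×-dec coloured?
      where
        coloured? : Dec (Σ[ p ∈ u ~ v ] colour p ≡ i)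
        coloured? with u ~? v
        ... | no ¬p = no λ (p , _) → ¬p p
        ... | yes p with colour p Fin.≟ i
        ...   | yes eq = yes (p , eq)
        ...   | no neq = no λ (q , eq) →
                  neq (trans (trans (unoriented p (~-sym p)) (unoriented (~-sym p) q)) eq)

    colourClass : Fin r → List (V G × V G)
    colourClass i = filter (represents? i) (cartesianProduct vertices vertices)

  smallerClass : EdgeColouring 2 → ℕ
  smallerClass c = length (colourClass c zero) ⊓ length (colourClass c (suc zero))

IsLeast : Pred ℕ _ → ℕ → Set
IsLeast P m = P m × (∀ {j} → P j → m ≤ j)

-- D′[ G ]≡ d : the number D′(G) is d.
D′[_]≡_ : Graph → ℕ → Set
D′[ G ]≡ d = IsLeast (λ r → Σ[ c ∈ EdgeColouring G r ] Distinguishing G c) d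

-- ρ′[ G ]≡ m : the number ρ′(G) is defined, i.e. D′(G) = 2, and equals m.
ρ′[_]≡_ : Graph → ℕ → Set
ρ′[ G ]≡ m =
  D′[ G ]≡ 2 ×
  IsLeast (λ s → Σ[ c ∈ EdgeColouring G 2 ] (Distinguishing G c × smallerClass G c ≡ s)) m

{-# OPTIONS --safe #-}
-- Fix an optimal colouring c of K n and call its smaller class red. For each coordinate i of the
-- power choose one line Lᵢ in direction i, namely the line on which coordinate j is lo for j < i
-- and hi for j > i; colour Lᵢ like c and every other edge with the other colour, which gives at
-- most k · ρ′(K n) red edges. An automorphism φ of the power permutes the directions by some π,
-- and φ(u) at π(i) is σᵢ(uᵢ). If φ preserves the colouring it maps Lᵢ to L_π(i), because both
-- contain red edges. Hence each σᵢ preserves c and is the identity, so π preserves the positions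
-- of the lines; these encode the order of the coordinates, so π is the identity as well.
--
-- Exact minima need more: whether a given cost is attained is decided by exhaustive search, and
-- distinguishing 2-colourings of K n exist by adding vertices to an asymmetric graph of order 6.
module Submission where

open import Defs
open import Data.Fin as Fin using (Fin; zero; suc; _≟_; #_; toℕ; combine; finToFun; funToFin; opposite)
open import Data.Fin.Induction using (<-weakInduction)
open import Data.Fin.Permutation using (Permutation′; transpose; remove; lift₀-remove)
import Data.Fin.Properties as Fin
open import Data.Fin.Properties using (all?; any?)
open import Data.List using (List; []; _∷_; _++_; length; map; cartesianProduct)
open import Data.List.Membership.Propositional using (_∈_)
open import Data.List.Membership.Propositional.Properties
  using (∈-∃++; ∈-++⁻; ∈-++⁺ˡ; ∈-++⁺ʳ; ∈-map⁺; ∈-allFin; ∈-filter⁻; ∈-filter⁺; ∈-cartesianProduct⁺)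
open import Data.List.Properties using (length-++; length-map; filter-≐)
open import Data.List.Relation.Unary.AllPairs using (_∷_)
open import Data.List.Relation.Unary.Any using (here; there)
open import Data.List.Relation.Unary.Unique.Propositional using (Unique)
import Data.List.Relation.Unary.Unique.Propositional.Properties as Unique
open import Data.Nat as ℕ using (ℕ; zero; suc; _+_; _*_; _≤_; _<_; z≤n; s≤s; NonZero; _⊓_)
import Data.Nat.Properties as ℕ
open import Data.Product using (∃; ∃₂; Σ-syntax; _×_; _,_; proj₁; proj₂)
open import Data.Product.Function.NonDependent.Propositional using (_×-↔_)
open import Data.Sum using (_⊎_; inj₁; inj₂)
open import Data.Vec using (Vec; []; _∷_; lookup)
open import Data.Vec.Functional using (updateAt)
open import Data.Vec.Functional.Properties using (updateAt-updates; updateAt-minimal)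
open import Function
  using (_∘_; case_of_; Inverse; Injection; Equivalence; mk⇔; mk↔ₛ′)
open import Function.Construct.Identity using (↔-id)
open import Function.Construct.Symmetry using (↔-sym)
open import Function.Properties.Inverse using (↔⇒↣)
open import Relation.Binary.Definitions using (tri<; tri≈; tri>)
open import Relation.Binary.PropositionalEquality
  using (_≡_; _≢_; refl; sym; trans; cong; cong₂; subst; subst₂; ≢-sym; module ≡-Reasoning)
open import Relation.Nullary using (¬_; Dec; yes; no; contradiction)
open import Relation.Nullary.Decidable
  using (map′; toWitness; dec-true; decidable-stable; _→-dec_; _×-dec_; ¬?)
open import Relation.Unary using (Pred; Decidable)

-- Counting by duplicate-free lists, and colour classes

-- Induction that deletes the head of `xs` from `ys`. It bounds a colour class by any list that
-- covers it.
Unique-⊆⇒length≤ : ∀ {A : Set} {xs ys : List A} → Unique xs → (∀ {x} → x ∈ xs → x ∈ ys) →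
                   length xs ≤ length ys
Unique-⊆⇒length≤ {xs = []} _ _ = z≤n
Unique-⊆⇒length≤ {xs = x ∷ xs} {ys} u@(_ ∷ u′) xs⊆ys
  with as , bs , refl ← ∈-∃++ (xs⊆ys (here refl)) = begin
  suc (length xs)             ≤⟨ s≤s (Unique-⊆⇒length≤ u′ xs⊆as++bs) ⟩
  suc (length (as ++ bs))     ≡⟨ cong suc (length-++ as) ⟩
  suc (length as + length bs) ≡⟨ ℕ.+-suc (length as) (length bs) ⟨
  length as + suc (length bs) ≡⟨ length-++ as ⟨
  length (as ++ x ∷ bs)       ∎
  where
    open ℕ.≤-Reasoning
    xs⊆as++bs : ∀ {y} → y ∈ xs → y ∈ as ++ bs
    xs⊆as++bs y∈xs with ∈-++⁻ as (xs⊆ys (there y∈xs))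
    ... | inj₁ y∈as         = ∈-++⁺ˡ y∈as
    ... | inj₂ (here refl)  = contradiction y∈xs (Unique.Unique[x∷xs]⇒x∉xs u)
    ... | inj₂ (there y∈bs) = ∈-++⁺ʳ as y∈bs

-- The index of a vertex of `G □ H` is `combine` of the indices in the factors, ordered
-- lexicographically. These two cancellations pass the chosen orientation of an edge down to the
-- factor in which it moves.
combine-cancelʳ-< : ∀ {m n} {i j : Fin m} {k : Fin n} → combine i k Fin.< combine j k → i Fin.< j
combine-cancelʳ-< {n = n} {i} {j} {k} lt = ℕ.*-cancelˡ-< n _ _ (ℕ.+-cancelʳ-< (toℕ k) _ _
  (subst₂ ℕ._<_ (Fin.toℕ-combine i k) (Fin.toℕ-combine j k) lt))

combine-cancelˡ-< : ∀ {m n} {i : Fin m} {j k : Fin n} → combine i j Fin.< combine i k → j Fin.< k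
combine-cancelˡ-< {n = n} {i} {j} {k} lt = ℕ.+-cancelˡ-< (n ℕ.* toℕ i) _ _
  (subst₂ ℕ._<_ (Fin.toℕ-combine i j) (Fin.toℕ-combine i k) lt)

module _ (G : Graph) where
  open Graph G using (enum; vertices)

  ∈-vertices : ∀ v → v ∈ vertices
  ∈-vertices v = subst (_∈ vertices) (Inverse.inverseʳ enum refl)
                   (∈-map⁺ (Inverse.from enum) (∈-allFin _))

  module _ {r : ℕ} (c : EdgeColouring G r) (i : Fin r) where

    colourClass-unique : Unique (colourClass G c i)
    colourClass-unique = Unique.filter⁺ (represents? G c i) (Unique.cartesianProduct⁺ u u)
      where
        u : Unique vertices
        u = Unique.map⁺ (Injection.injective (↔⇒↣ (↔-sym enum))) (Unique.allFin⁺ _)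

    ∈-colourClass⁻ : ∀ {e} → e ∈ colourClass G c i → Represents G c i e
    ∈-colourClass⁻ = proj₂ ∘ ∈-filter⁻ (represents? G c i) {xs = cartesianProduct vertices vertices}

    ∈-colourClass⁺ : ∀ {e} → Represents G c i e → e ∈ colourClass G c i
    ∈-colourClass⁺ = ∈-filter⁺ (represents? G c i) (∈-cartesianProduct⁺ (∈-vertices _) (∈-vertices _))

-- Coordinates on the power of K n

module Hamming (n : ℕ) where

  at : ∀ k → V (K n ^ suc k) → Fin (suc k) → Fin n
  at zero    u       _       = u
  at (suc k) (g , h) zero    = g
  at (suc k) (g , h) (suc i) = at k h i

  build : ∀ k → (Fin (suc k) → Fin n) → V (K n ^ suc k)
  build zero    f = f zero
  build (suc k) f = f zero , build k (f ∘ suc)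

  at-build : ∀ k f i → at k (build k f) i ≡ f i
  at-build zero    f zero    = refl
  at-build (suc k) f zero    = refl
  at-build (suc k) f (suc i) = at-build k (f ∘ suc) i

  at-ext : ∀ k {u v} → (∀ i → at k u i ≡ at k v i) → u ≡ v
  at-ext zero    eq = eq zero
  at-ext (suc k) eq = cong₂ _,_ (eq zero) (at-ext k (eq ∘ suc))

  module _ (k : ℕ) where
    open Graph (K n ^ suc k) using (_~_)

    infix 4 _~[_]_
    _~[_]_ : V (K n ^ suc k) → Fin (suc k) → V (K n ^ suc k) → Set
    u ~[ i ] v = at k u i ≢ at k v i × (∀ j → j ≢ i → at k u j ≡ at k v j)

    Adjacent : V (K n ^ suc k) → V (K n ^ suc k) → Set
    Adjacent u v = ∃ λ i → u ~[ i ] v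

  ~⇒Adjacent : ∀ k {u v} → Graph._~_ (K n ^ suc k) u v → Adjacent k u v
  ~⇒Adjacent zero u≢v = zero , u≢v , λ { zero j≢0 → contradiction refl j≢0 }
  ~⇒Adjacent (suc k) (inj₁ (refl , h~h′)) with i , h≢h′ , eq ← ~⇒Adjacent k h~h′ =
    suc i , h≢h′ , λ where
      zero    _     → refl
      (suc j) 1+j≢1+i → eq j (1+j≢1+i ∘ cong suc)
  ~⇒Adjacent (suc k) (inj₂ (g≢g′ , refl)) = zero , g≢g′ , λ where
    zero    0≢0 → contradiction refl 0≢0
    (suc j) _   → refl

  Adjacent⇒~ : ∀ k {u v} → Adjacent k u v → Graph._~_ (K n ^ suc k) u v
  Adjacent⇒~ zero    (zero , u≢v , _) = u≢v
  Adjacent⇒~ (suc k) (zero , g≢g′ , eq) = inj₂ (g≢g′ , at-ext k λ j → eq (suc j) λ ())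
  Adjacent⇒~ (suc k) (suc i , h≢h′ , eq) =
    inj₁ (eq zero (λ ()) , Adjacent⇒~ k (i , h≢h′ , λ j j≢i → eq (suc j) (j≢i ∘ Fin.suc-injective)))

  -- Connectedness in the form of an induction principle: change the first coordinate in one step,
  -- then the others recursively.
  connected : ∀ k (P : V (K n ^ suc k) → Set) → (∀ {u v} → Adjacent k u v → P u → P v) →
              ∀ {u v} → P u → P v
  connected zero P step {u} {v} Pu with u ≟ v
  ... | yes refl = Pu
  ... | no  u≢v  = step (~⇒Adjacent zero u≢v) Pu
  connected (suc k) P step {g , h} {g′ , h′} Pu with g ≟ g′
  ... | yes refl = connected k (λ h → P (g , h))
                     (λ a → step (~⇒Adjacent (suc k) (inj₁ (refl , Adjacent⇒~ k a)))) Pu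
  ... | no g≢g′ = connected k (λ h → P (g′ , h))
                     (λ a → step (~⇒Adjacent (suc k) (inj₁ (refl , Adjacent⇒~ k a))))
                     (step (~⇒Adjacent (suc k) (inj₂ (g≢g′ , refl))) Pu)

-- Directions of edges

module Directions (n k : ℕ) where
  open Hamming n public hiding (at; _~[_]_; Adjacent)

  Vertex : Set
  Vertex = V (K n ^ suc k)

  at : Vertex → Fin (suc k) → Fin n
  at = Hamming.at n k

  infix 4 _~[_]_
  _~[_]_ : Vertex → Fin (suc k) → Vertex → Set
  _~[_]_ = Hamming._~[_]_ n k

  Adjacent : Vertex → Vertex → Set
  Adjacent = Hamming.Adjacent n k

  infixl 6 _[_≔_]
  _[_≔_] : Vertex → Fin (suc k) → Fin n → Vertex
  u [ i ≔ x ] = build k (updateAt (at u) i (λ _ → x))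

  at-set : ∀ u i x → at (u [ i ≔ x ]) i ≡ x
  at-set u i x = trans (at-build k _ i) (updateAt-updates i (at u))

  at-set-≢ : ∀ u {i j} x → j ≢ i → at (u [ i ≔ x ]) j ≡ at u j
  at-set-≢ u {i} {j} x j≢i = trans (at-build k _ j) (updateAt-minimal j i (at u) j≢i)

  ext-at : ∀ i {u v} → at u i ≡ at v i → (∀ j → j ≢ i → at u j ≡ at v j) → u ≡ v
  ext-at i eq eqs = at-ext k λ j → case j ≟ i of λ where
    (yes refl) → eq
    (no  j≢i)  → eqs j j≢i

  set-~ : ∀ u i {x} → x ≢ at u i → u ~[ i ] u [ i ≔ x ]
  set-~ u i x≢uᵢ =
    (λ eq → x≢uᵢ (sym (trans eq (at-set u i _)))) , λ j j≢i → sym (at-set-≢ u _ j≢i)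

  set-cong : ∀ {u v i j} x → j ≢ i → u ~[ j ] v → u [ i ≔ x ] ~[ j ] v [ i ≔ x ]
  set-cong {u} {v} {i} {j} x j≢i (uⱼ≢vⱼ , eq) =
    (λ e → uⱼ≢vⱼ (trans (sym (at-set-≢ u x j≢i)) (trans e (at-set-≢ v x j≢i)))) ,
    λ l l≢j → case l ≟ i of λ where
      (yes refl) → trans (at-set u i x) (sym (at-set v i x))
      (no  l≢i)  → trans (at-set-≢ u x l≢i) (trans (eq l l≢j) (sym (at-set-≢ v x l≢i)))

  set-at : ∀ u i → u [ i ≔ at u i ] ≡ u
  set-at u i = ext-at i (at-set u i _) λ j → at-set-≢ u _

  set-set : ∀ {u v} i {x} → u ~[ i ] v → u [ i ≔ x ] ≡ v [ i ≔ x ]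
  set-set {u} {v} i {x} (_ , eq) = ext-at i (trans (at-set u i x) (sym (at-set v i x)))
    λ j j≢i → trans (at-set-≢ u x j≢i) (trans (eq j j≢i) (sym (at-set-≢ v x j≢i)))

  ~-swap : ∀ {u v i} → u ~[ i ] v → v ~[ i ] u
  ~-swap (ne , eq) = ≢-sym ne , λ j j≢i → sym (eq j j≢i)

  ~-direction : ∀ {u v i j} → u ~[ i ] v → at u j ≢ at v j → j ≡ i
  ~-direction {i = i} {j} (_ , eq) uⱼ≢vⱼ = decidable-stable (j ≟ i) (uⱼ≢vⱼ ∘ eq j)

  ~-same-direction : ∀ {u v w i} → u ~[ i ] v → u ~[ i ] w → v ≢ w → v ~[ i ] w
  ~-same-direction {u} {v} {w} {i} (_ , eq) (_ , eq′) v≢w =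
    (λ vᵢ≡wᵢ → v≢w (ext-at i vᵢ≡wᵢ eq″)) , eq″
    where
      eq″ : ∀ j → j ≢ i → at v j ≡ at w j
      eq″ j j≢i = trans (sym (eq j j≢i)) (eq′ j j≢i)

  -- Triangles lie on a line: if `i ≢ j`, then `v` and `w` differ at both `i` and `j`, yet an edge
  -- changes only one coordinate.
  ~-triangle : ∀ {u v w i j l} → u ~[ i ] v → u ~[ j ] w → v ~[ l ] w → i ≡ j
  ~-triangle {i = i} {j} u~v u~w v~w = decidable-stable (i ≟ j) λ i≢j → i≢j (trans
    (~-direction v~w λ vᵢ≡wᵢ → proj₁ u~v (trans (proj₂ u~w i i≢j) (sym vᵢ≡wᵢ)))
    (sym (~-direction v~w λ vⱼ≡wⱼ → proj₁ u~w (trans (proj₂ u~v j (≢-sym i≢j)) vⱼ≡wⱼ))))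

  -- Opposite sides of a 4-cycle that turns at `u` are parallel. Otherwise `x` agrees with `u` at
  -- `i`, so the step from `v` to `x` undoes the step from `u` to `v` and the cycle collapses.
  ~-square : ∀ {u v w x i j p q} → u ~[ i ] v → u ~[ j ] w → v ~[ p ] x → w ~[ q ] x →
             i ≢ j → x ≢ u → w ~[ i ] x
  ~-square {u} {v} {w} {x} {i} {j} {p} {q} u~v u~w v~x w~x i≢j x≢u with q ≟ i
  ... | yes refl = w~x
  ... | no  q≢i  = contradiction (sym (ext-at i uᵢ≡xᵢ eqs)) x≢u
    where
      uᵢ≡xᵢ : at u i ≡ at x i
      uᵢ≡xᵢ = trans (proj₂ u~w i i≢j) (proj₂ w~x i (≢-sym q≢i))

      i≡p : i ≡ p
      i≡p = ~-direction v~x λ vᵢ≡xᵢ → proj₁ u~v (trans uᵢ≡xᵢ (sym vᵢ≡xᵢ))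

      eqs : ∀ l → l ≢ i → at u l ≡ at x l
      eqs l l≢i = trans (proj₂ u~v l l≢i) (proj₂ v~x l λ l≡p → l≢i (trans l≡p (sym i≡p)))

-- Inverse automorphisms

module _ {G : Graph} where
  open Graph G using (_~_; ~-sym)

  inverse : Automorphism G → Automorphism G
  inverse φ = record
    { perm = ↔-sym perm
    ; adj  = mk⇔
        (λ p → Equivalence.from adj (subst₂ _~_ (sym (inverseˡ refl)) (sym (inverseˡ refl)) p))
        (λ p → subst₂ _~_ (inverseˡ refl) (inverseˡ refl) (Equivalence.to adj p))
    }
    where
      open Automorphism φ
      open Inverse perm using (inverseˡ)

  module _ {r : ℕ} (c : EdgeColouring G r) where
    open EdgeColouring c

    -- Reversing the edge and back removes the dependence of the colour on the adjacency proof.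
    colour-cong : ∀ {u v u′ v′} → u ≡ u′ → v ≡ v′ → (p : u ~ v) (q : u′ ~ v′) → colour p ≡ colour q
    colour-cong refl refl p q = trans (unoriented p (~-sym p)) (unoriented (~-sym p) q)

    inverse-preserves : ∀ φ → Preserves G c φ → Preserves G c (inverse φ)
    inverse-preserves φ pres p =
      trans (sym (pres _)) (colour-cong (inverseˡ refl) (inverseˡ refl) _ p)
      where
        open Automorphism φ
        open Inverse perm using (inverseˡ)

-- Automorphisms of the power

module Decomposition
  (n k : ℕ) (o z : Fin n) (o≢z : o ≢ z) (aut : Automorphism (K n ^ suc k)) where
  open Directions n k
  open Automorphism aut

  φ : Vertex → Vertex
  φ = apply

  φ-injective : ∀ {u v} → φ u ≡ φ v → u ≡ v
  φ-injective = Injection.injective (↔⇒↣ perm)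

  φ-adj : ∀ {u v} → Adjacent u v → Adjacent (φ u) (φ v)
  φ-adj a = ~⇒Adjacent k (Equivalence.to adj (Adjacent⇒~ k a))

  φ-reflects : ∀ {u v} → Adjacent (φ u) (φ v) → Adjacent u v
  φ-reflects a = ~⇒Adjacent k (Equivalence.from adj (Adjacent⇒~ k a))

  -- A second value for every coordinate, so that each vertex has a neighbour in each direction.
  other : Fin n → Fin n
  other x with x ≟ o
  ... | yes _ = z
  ... | no  _ = o

  other-≢ : ∀ x → other x ≢ x
  other-≢ x with x ≟ o
  ... | yes refl = ≢-sym o≢z
  ... | no  x≢o  = ≢-sym x≢o

  -- Three points of a line form a triangle; so do their images, and triangles lie on a line.
  collinear : ∀ {u v w i p} → u ~[ i ] v → u ~[ i ] w → φ u ~[ p ] φ v → φ u ~[ p ] φ w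
  collinear {u} {v} {w} {i} {p} u~v u~w φu~φv with at v i ≟ at w i
  ... | yes vᵢ≡wᵢ = subst (λ w → φ u ~[ p ] φ w)
          (ext-at i vᵢ≡wᵢ λ j j≢i → trans (sym (proj₂ u~v j j≢i)) (proj₂ u~w j j≢i)) φu~φv
  ... | no  vᵢ≢wᵢ
    with l , φv~φw ← φ-adj (i , ~-same-direction u~v u~w λ { refl → vᵢ≢wᵢ refl })
    with q , φu~φw ← φ-adj (i , u~w) =
      subst (φ u ~[_] φ w) (sym (~-triangle φu~φv φu~φw φv~φw)) φu~φw

  -- If both images had the same direction, `φ v` and `φ w` would be adjacent, hence also `v` and
  -- `w`, and the triangle would force `i ≡ j`.
  transverse : ∀ {u v w i j p q} → i ≢ j → u ~[ i ] v → u ~[ j ] w →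
               φ u ~[ p ] φ v → φ u ~[ q ] φ w → p ≢ q
  transverse i≢j u~v u~w φu~φv φu~φw refl = i≢j (~-triangle u~v u~w
    (proj₂ (φ-reflects (_ , ~-same-direction φu~φv φu~φw λ φv≡φw → v≢w (φ-injective φv≡φw)))))
    where
      v≢w : _ ≢ _
      v≢w refl = i≢j (sym (~-direction u~v (proj₁ u~w)))

  -- The 4-cycle through `u`, `v`, `x`, `w` maps to a 4-cycle that still turns at `φ u` by
  -- `transverse`, so its opposite sides are parallel.
  parallel : ∀ {u v w i j p} → i ≢ j → u ~[ i ] v → u ~[ j ] w → φ u ~[ p ] φ v →
             φ w ~[ p ] φ (w [ i ≔ at v i ])
  parallel {u} {v} {w} {i} {j} i≢j u~v u~w φu~φv =
    ~-square φu~φv (proj₂ φu~φw) (proj₂ (φ-adj (j , v~x))) (proj₂ (φ-adj (i , w~x)))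
      (transverse i≢j u~v u~w φu~φv (proj₂ φu~φw)) λ φx≡φu → x≢u (φ-injective φx≡φu)
    where
      x : Vertex
      x = w [ i ≔ at v i ]

      φu~φw : Adjacent (φ u) (φ w)
      φu~φw = φ-adj (j , u~w)

      vᵢ≢wᵢ : at v i ≢ at w i
      vᵢ≢wᵢ eq = proj₁ u~v (trans (proj₂ u~w i i≢j) (sym eq))

      w~x : w ~[ i ] x
      w~x = set-~ w i vᵢ≢wᵢ

      v~x : v ~[ j ] x
      v~x = subst (_~[ j ] x) (trans (set-set i u~v) (set-at v i))
              (set-cong (at v i) (≢-sym i≢j) u~w)

      x≢u : x ≢ u
      x≢u x≡u = proj₁ u~v (trans (cong (λ y → at y i) (sym x≡u)) (at-set w i _))

  origin : Vertex
  origin = build k λ _ → o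

  private
    φ-edge : ∀ u i → Adjacent (φ u) (φ (u [ i ≔ other (at u i) ]))
    φ-edge u i = φ-adj (i , set-~ u i (other-≢ (at u i)))

  -- Read off at `origin`; `φ-direction` shows that any other base vertex gives the same permutation
  -- of directions.
  π : Fin (suc k) → Fin (suc k)
  π i = proj₁ (φ-edge origin i)

  -- Spreads from `origin` by connectedness: a step in direction `i` itself is handled by
  -- `collinear`, a step in another direction by `parallel`.
  φ-direction : ∀ {u v i} → u ~[ i ] v → φ u ~[ π i ] φ v
  φ-direction {i = i} u~v =
    connected k (λ u → ∀ {v} → u ~[ i ] v → φ u ~[ π i ] φ v) step
      (λ u~v → collinear (set-~ origin i (other-≢ _)) u~v (proj₂ (φ-edge origin i))) u~v
    where
      step : ∀ {u w} → Adjacent u w → (∀ {v} → u ~[ i ] v → φ u ~[ π i ] φ v) →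
             ∀ {v} → w ~[ i ] v → φ w ~[ π i ] φ v
      step {u} {w} (j , u~w) ih w~v with i ≟ j
      ... | yes refl = collinear (~-swap u~w) w~v (~-swap (ih u~w))
      ... | no  i≢j  = collinear
              (set-~ w i λ eq → proj₁ u~x (trans (proj₂ u~w i i≢j) (sym eq)))
              w~v (parallel i≢j u~x u~w (ih u~x))
        where
          u~x : u ~[ i ] u [ i ≔ other (at u i) ]
          u~x = set-~ u i (other-≢ _)

  π-injective : ∀ {i j} → i ≢ j → π i ≢ π j
  π-injective {i} {j} i≢j = transverse i≢j u~v u~w (φ-direction u~v) (φ-direction u~w)
    where
      u~v : origin ~[ i ] _
      u~v = set-~ origin i (other-≢ _)

      u~w : origin ~[ j ] _
      u~w = set-~ origin j (other-≢ _)

  σ : Fin (suc k) → Fin n → Fin n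
  σ i x = at (φ (origin [ i ≔ x ])) (π i)

  -- Changing a coordinate `j ≢ i` moves the image in direction `π j`, which differs from `π i`, so
  -- coordinate `π i` of the image depends on coordinate `i` alone.
  at-φ : ∀ u i → at (φ u) (π i) ≡ σ i (at u i)
  at-φ u i = trans (cong (λ u → at (φ u) (π i)) (sym (set-at u i)))
    (connected k (λ v → at (φ (v [ i ≔ at u i ])) (π i) ≡ σ i (at u i)) step refl)
    where
      step : ∀ {v w} → Adjacent v w → at (φ (v [ i ≔ at u i ])) (π i) ≡ σ i (at u i) →
             at (φ (w [ i ≔ at u i ])) (π i) ≡ σ i (at u i)
      step {v} {w} (j , v~w) ih with i ≟ j
      ... | yes refl = trans (cong (λ y → at (φ y) (π i)) (sym (set-set i v~w))) ih
      ... | no  i≢j  = trans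
              (sym (proj₂ (φ-direction (set-cong (at u i) (≢-sym i≢j) v~w)) (π i)
                (π-injective i≢j))) ih

two-colours : ∀ {i j : Fin 2} l → i ≢ l → j ≢ l → i ≡ j
two-colours {zero}     {zero}     _          _   _   = refl
two-colours {suc zero} {suc zero} _          _   _   = refl
two-colours {zero}     {suc zero} zero       i≢l _   = contradiction refl i≢l
two-colours {zero}     {suc zero} (suc zero) _   j≢l = contradiction refl j≢l
two-colours {suc zero} {zero}     zero       _   j≢l = contradiction refl j≢l
two-colours {suc zero} {zero}     (suc zero) i≢l _   = contradiction refl i≢l

-- Each step up raises `f` by at least one. Applied to a permutation and to its inverse, this forces
-- the identity.
monotone⇒increasing : ∀ {m} (f : Fin (suc m) → Fin (suc m)) →
                      (∀ {i j} → i Fin.< j → f i Fin.< f j) → ∀ i → i Fin.≤ f i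
monotone⇒increasing f f-mono = <-weakInduction (λ i → i Fin.≤ f i) z≤n λ i i≤fi →
  ℕ.≤-trans (s≤s (ℕ.≤-trans (ℕ.≤-reflexive (sym (Fin.toℕ-inject₁ i))) i≤fi))
            (f-mono (s≤s (ℕ.≤-reflexive (Fin.toℕ-inject₁ i))))

-- The colouring of the power

module LayerColouring
  (n : ℕ) (lo hi : Fin n) (lo≢hi : lo ≢ hi) (c : EdgeColouring (K n) 2)
  (red blue : Fin 2) (red≢blue : red ≢ blue) where

  private module c = EdgeColouring c
  open Hamming n hiding (_~[_]_; Adjacent)

  top : ∀ k → V (K n ^ suc k)
  top k = build k λ _ → hi

  private
    top? : ∀ k (u : V (K n ^ suc k)) → Dec (u ≡ top k)
    top? k u = Graph._≟_ (K n ^ suc k) u (top k)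

  -- The distinguished lines by recursion: the line in the first direction runs over the vertex
  -- `top k`, and all later ones lie in the layer where the first coordinate is `lo`.
  layerColour : ∀ k {u v} → Graph._~_ (K n ^ suc k) u v → Fin 2
  layerColour zero p = c.colour p
  layerColour (suc k) {g , h} (inj₁ (_ , h~h′)) with g ≟ lo
  ... | yes _ = layerColour k h~h′
  ... | no  _ = blue
  layerColour (suc k) {g , h} (inj₂ (g≢g′ , _)) with top? k h
  ... | yes _ = c.colour g≢g′
  ... | no  _ = blue

  layerColour-unoriented : ∀ k {u v} (p : Graph._~_ (K n ^ suc k) u v)
                           (q : Graph._~_ (K n ^ suc k) v u) → layerColour k p ≡ layerColour k q
  layerColour-unoriented zero p q = c.unoriented p q
  layerColour-unoriented (suc k) {g , h} (inj₁ (refl , p)) (inj₁ (_ , q)) with g ≟ lo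
  ... | yes _ = layerColour-unoriented k p q
  ... | no  _ = refl
  layerColour-unoriented (suc k) (inj₁ (refl , _)) (inj₂ (g≢g , _)) = contradiction refl g≢g
  layerColour-unoriented (suc k) (inj₂ (g≢g , _)) (inj₁ (refl , _)) = contradiction refl g≢g
  layerColour-unoriented (suc k) {g , h} (inj₂ (p , refl)) (inj₂ (q , _)) with top? k h
  ... | yes _ = c.unoriented p q
  ... | no  _ = refl

  layerColouring : ∀ k → EdgeColouring (K n ^ suc k) 2
  layerColouring k = record
    { colour = λ {u} {v} → layerColour k {u} {v} ; unoriented = layerColour-unoriented k }

  -- anchor i j is coordinate j ≠ i of the points of the line Lᵢ; the value anchor i i is junk.
  anchor : ∀ {m} → Fin m → Fin m → Fin n
  anchor zero    _       = hi
  anchor (suc _) zero    = lo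
  anchor (suc i) (suc j) = anchor i j

  anchor-< : ∀ {m} {i j : Fin m} → i Fin.< j → anchor i j ≡ hi
  anchor-< {i = zero}              _         = refl
  anchor-< {i = suc i} {j = suc j} (s≤s i<j) = anchor-< i<j

  anchor-> : ∀ {m} {i j : Fin m} → j Fin.< i → anchor i j ≡ lo
  anchor-> {i = suc i} {j = zero}  _         = refl
  anchor-> {i = suc i} {j = suc j} (s≤s j<i) = anchor-> j<i

  Red : Fin n → Fin n → Set
  Red x y = Σ[ x≢y ∈ x ≢ y ] c.colour x≢y ≡ red

  OnLine : ∀ k → Fin (suc k) → V (K n ^ suc k) → Set
  OnLine k i u = ∀ j → j ≢ i → at k u j ≡ anchor i j

  -- The non-recursive description of the red edges, by direction and position; `red⇒RedEdge` and
  -- `RedEdge⇒red` translate. Only `u` is placed on the line, as `v` agrees with it off coordinate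
  -- `i`.
  RedEdge : ∀ k → Fin (suc k) → V (K n ^ suc k) → V (K n ^ suc k) → Set
  RedEdge k i u v = Hamming._~[_]_ n k u i v × OnLine k i u × Red (at k u i) (at k v i)

  red⇒RedEdge : ∀ k {u v} (p : Graph._~_ (K n ^ suc k) u v) → layerColour k p ≡ red →
                ∃ λ i → RedEdge k i u v
  red⇒RedEdge zero p eq =
    zero , (p , λ { zero 0≢0 → contradiction refl 0≢0 })
         , (λ { zero 0≢0 → contradiction refl 0≢0 }) , p , eq
  red⇒RedEdge (suc k) {g , h} (inj₁ (refl , p)) eq with g ≟ lo
  ... | no  _    = contradiction (sym eq) red≢blue
  ... | yes g≡lo with i , (h≢h′ , eqs) , on , r ← red⇒RedEdge k p eq =
    suc i
    , (h≢h′ , λ { zero _ → refl ; (suc j) ne → eqs j (ne ∘ cong suc) })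
    , (λ { zero _ → g≡lo ; (suc j) ne → on j (ne ∘ cong suc) })
    , r
  red⇒RedEdge (suc k) {g , h} (inj₂ (g≢g′ , refl)) eq with top? k h
  ... | no  _    = contradiction (sym eq) red≢blue
  ... | yes refl =
    zero
    , (g≢g′ , λ { zero 0≢0 → contradiction refl 0≢0 ; (suc j) _ → refl })
    , (λ { zero 0≢0 → contradiction refl 0≢0 ; (suc j) _ → at-build k _ j })
    , g≢g′ , eq

  RedEdge⇒red : ∀ k {i u v} → RedEdge k i u v → (p : Graph._~_ (K n ^ suc k) u v) →
                layerColour k p ≡ red
  RedEdge⇒red zero {zero} (_ , _ , q , eq) p = trans (colour-cong c refl refl p q) eq
  RedEdge⇒red (suc k) {zero} (e , _) (inj₁ (refl , _)) = contradiction refl (proj₁ e)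
  RedEdge⇒red (suc k) {suc i} ((_ , eqs) , _) (inj₂ (g≢g′ , _)) = contradiction (eqs zero λ ()) g≢g′
  RedEdge⇒red (suc k) {suc i} {g , h} ((ne , eqs) , on , r) (inj₁ (_ , p)) with g ≟ lo
  ... | yes _    = RedEdge⇒red k
        ( (ne , λ j j≢i → eqs (suc j) (j≢i ∘ Fin.suc-injective))
        , (λ j j≢i → on (suc j) (j≢i ∘ Fin.suc-injective)) , r) p
  ... | no  g≢lo = contradiction (on zero λ ()) g≢lo
  RedEdge⇒red (suc k) {zero} {g , h} (_ , on , q , eq) (inj₂ (p , _)) with top? k h
  ... | yes _    = trans (colour-cong c refl refl p q) eq
  ... | no  h≢top =
    contradiction (at-ext k λ j → trans (on (suc j) λ ()) (sym (at-build k _ j))) h≢top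

  -- A list covering all red edges: a copy of the red class of `K n` on the first line and a copy of
  -- the red class of the smaller power in the layer `lo`.
  layer-edges : ∀ k → List (V (K n ^ suc (suc k)) × V (K n ^ suc (suc k)))
  layer-edges k =
    map (λ (g , g′) → (g , top k) , (g′ , top k)) (colourClass (K n) c red) ++
    map (λ (h , h′) → (lo , h) , (lo , h′)) (colourClass (K n ^ suc k) (layerColouring k) red)

  Represents⇒∈-layer-edges : ∀ k {e} →
    Represents (K n ^ suc (suc k)) (layerColouring (suc k)) red e → e ∈ layer-edges k
  Represents⇒∈-layer-edges k {(g , h) , (g′ , h′)} (lt , inj₁ (refl , h~h′) , eq) with g ≟ lo
  ... | no  _    = contradiction (sym eq) red≢blue
  ... | yes refl = ∈-++⁺ʳ _ (∈-map⁺ _ (∈-colourClass⁺ (K n ^ suc k) (layerColouring k) red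
          (combine-cancelˡ-< {i = g} lt , h~h′ , eq)))
  Represents⇒∈-layer-edges k {(g , h) , (g′ , h′)} (lt , inj₂ (g≢g′ , refl) , eq) with top? k h
  ... | no  _    = contradiction (sym eq) red≢blue
  ... | yes refl = ∈-++⁺ˡ (∈-map⁺ _ (∈-colourClass⁺ (K n) c red
          (combine-cancelʳ-< {i = g} lt , g≢g′ , eq)))

  length-layerClass : ∀ k → length (colourClass (K n ^ suc k) (layerColouring k) red) ≤
                            suc k * length (colourClass (K n) c red)
  length-layerClass zero    = ℕ.≤-reflexive (sym (ℕ.+-identityʳ _))
  length-layerClass (suc k) = begin
    length (colourClass (K n ^ suc (suc k)) (layerColouring (suc k)) red)
      ≤⟨ Unique-⊆⇒length≤ (colourClass-unique (K n ^ suc (suc k)) (layerColouring (suc k)) red)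
           (λ e∈ → Represents⇒∈-layer-edges k
             (∈-colourClass⁻ (K n ^ suc (suc k)) (layerColouring (suc k)) red e∈)) ⟩
    length (layer-edges k)
      ≡⟨ trans (length-++ (map _ (colourClass (K n) c red)))
               (cong₂ _+_ (length-map _ (colourClass (K n) c red))
                 (length-map _ (colourClass (K n ^ suc k) (layerColouring k) red))) ⟩
    length (colourClass (K n) c red) + length (colourClass (K n ^ suc k) (layerColouring k) red)
      ≤⟨ ℕ.+-monoʳ-≤ _ (length-layerClass k) ⟩
    suc (suc k) * length (colourClass (K n) c red) ∎
    where open ℕ.≤-Reasoning

  -- Automorphisms that preserve the colouring of the power

  module Preserving (k : ℕ) (aut : Automorphism (K n ^ suc k))
    (pres : Preserves (K n ^ suc k) (layerColouring k) aut) (x₀ y₀ : Fin n) (red₀ : Red x₀ y₀) where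

    open Directions n k hiding (at; at-ext; at-build; build; connected; ~⇒Adjacent; Adjacent⇒~)
    open Automorphism aut using (adj)
    open Decomposition n k lo hi lo≢hi aut public

    -- The image is red, so it lies on some distinguished line; its direction is `π i`, which
    -- identifies that line.
    φ-red : ∀ {i u v} → RedEdge k i u v → RedEdge k (π i) (φ u) (φ v)
    φ-red {i} {u} {v} r@(u~v , _) = subst (λ i → RedEdge k i (φ u) (φ v))
        (~-direction (φ-direction u~v) (proj₁ (proj₁ r′))) r′
      where
        p : Graph._~_ (K n ^ suc k) u v
        p = Adjacent⇒~ k (i , u~v)

        r″ : ∃ λ i → RedEdge k i (φ u) (φ v)
        r″ = red⇒RedEdge k (Equivalence.to adj p) (trans (pres p) (RedEdge⇒red k r p))

        r′ : RedEdge k (proj₁ r″) (φ u) (φ v)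
        r′ = proj₂ r″

    line : Fin (suc k) → Fin n → Vertex
    line i x = build k (anchor i) [ i ≔ x ]

    at-line : ∀ i x → at k (line i x) i ≡ x
    at-line i x = at-set (build k (anchor i)) i x

    line-onLine : ∀ i x → OnLine k i (line i x)
    line-onLine i x j j≢i = trans (at-set-≢ (build k (anchor i)) x j≢i) (at-build k (anchor i) j)

    line-~ : ∀ i {x y} → x ≢ y → line i x ~[ i ] line i y
    line-~ i {x} {y} x≢y =
      (λ eq → x≢y (trans (sym (at-line i x)) (trans eq (at-line i y)))) ,
      λ j j≢i → trans (line-onLine i x j j≢i) (sym (line-onLine i y j j≢i))

    line-red : ∀ i {x y} → Red x y → RedEdge k i (line i x) (line i y)
    line-red i {x} {y} r@(x≢y , _) =
      line-~ i x≢y , line-onLine i x , subst₂ Red (sym (at-line i x)) (sym (at-line i y)) r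

    at-φ-line : ∀ i x → at k (φ (line i x)) (π i) ≡ σ i x
    at-φ-line i x = trans (at-φ (line i x) i) (cong (σ i) (at-line i x))

    -- The red edge from `x₀` to `y₀` on the line anchors the image of the point over `x₀`. Every
    -- other point is joined to that one in direction `i`, so its image differs from the anchored
    -- one only at `π i`.
    φ-line-onLine : ∀ i x → OnLine k (π i) (φ (line i x))
    φ-line-onLine i x j j≢πi with x ≟ x₀
    ... | yes refl = proj₁ (proj₂ (φ-red (line-red i red₀))) j j≢πi
    ... | no  x≢x₀ = trans (proj₂ (φ-direction (line-~ i x≢x₀)) j j≢πi)
                       (proj₁ (proj₂ (φ-red (line-red i red₀))) j j≢πi)

    σ-red : ∀ i {x y} → Red x y → Red (σ i x) (σ i y)
    σ-red i {x} {y} r =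
      subst₂ Red (at-φ-line i x) (at-φ-line i y) (proj₂ (proj₂ (φ-red (line-red i r))))

    σ-injective : ∀ i {x y} → σ i x ≡ σ i y → x ≡ y
    σ-injective i {x} {y} eq = decidable-stable (x ≟ y) λ x≢y →
      proj₁ (φ-direction (line-~ i x≢y)) (trans (at-φ-line i x) (trans eq (sym (at-φ-line i y))))

    -- A red pair after `σ i` makes the image of the edge on line `i` red, as it lies on line `π i`;
    -- by preservation the edge itself is red.
    σ-reflects-red : ∀ i {x y} → x ≢ y → Red (σ i x) (σ i y) → Red x y
    σ-reflects-red i {x} {y} x≢y r =
      subst₂ Red (trans (cong (at k (line i x)) j≡i) (at-line i x))
        (trans (cong (at k (line i y)) j≡i) (at-line i y)) (proj₂ (proj₂ (proj₂ edge)))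
      where
        p : Graph._~_ (K n ^ suc k) (line i x) (line i y)
        p = Adjacent⇒~ k (i , line-~ i x≢y)

        image : RedEdge k (π i) (φ (line i x)) (φ (line i y))
        image = φ-direction (line-~ i x≢y) , φ-line-onLine i x
              , subst₂ Red (sym (at-φ-line i x)) (sym (at-φ-line i y)) r

        edge : ∃ λ j → RedEdge k j (line i x) (line i y)
        edge = red⇒RedEdge k p (trans (sym (pres p)) (RedEdge⇒red k image _))

        j≡i : proj₁ edge ≡ i
        j≡i = ~-direction (line-~ i x≢y) (proj₁ (proj₁ (proj₂ edge)))

    -- For `i < j`, line `i` has `hi` at `j`, and `φ` carries this value unchanged to position `π j`
    -- of line `π i`. If `π j < π i`, the value there is `lo`.
    π-monotone : (∀ i x → σ i x ≡ x) → ∀ {i j} → i Fin.< j → π i Fin.< π j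
    π-monotone σ-id {i} {j} i<j with Fin.<-cmp (π i) (π j)
    ... | tri< πi<πj _ _ = πi<πj
    ... | tri≈ _ πi≡πj _ = contradiction πi≡πj (π-injective (Fin.<⇒≢ i<j))
    ... | tri> _ πi≢πj πj<πi = contradiction (begin
      lo                         ≡⟨ anchor-> πj<πi ⟨
      anchor (π i) (π j)         ≡⟨ φ-line-onLine i x₀ (π j) (≢-sym πi≢πj) ⟨
      at k (φ (line i x₀)) (π j) ≡⟨ at-φ (line i x₀) j ⟩
      σ j (at k (line i x₀) j)   ≡⟨ σ-id j _ ⟩
      at k (line i x₀) j         ≡⟨ line-onLine i x₀ j (≢-sym (Fin.<⇒≢ i<j)) ⟩
      anchor i j                 ≡⟨ anchor-< i<j ⟩
      hi                         ∎) lo≢hi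
      where open ≡-Reasoning

  -- A one-sided inverse suffices here, so the module can be applied to an automorphism and its
  -- inverse in either order.
  module Pair (k : ℕ) (x₀ y₀ : Fin n) (red₀ : Red x₀ y₀)
    (aut aut′ : Automorphism (K n ^ suc k))
    (pres : Preserves (K n ^ suc k) (layerColouring k) aut)
    (pres′ : Preserves (K n ^ suc k) (layerColouring k) aut′)
    (inv : ∀ u → Automorphism.apply aut′ (Automorphism.apply aut u) ≡ u) where

    private
      module F = Preserving k aut pres x₀ y₀ red₀
      module B = Preserving k aut′ pres′ x₀ y₀ red₀
    open Directions n k using (~-direction; at-set; _~[_]_)

    π′∘π : ∀ i → B.π (F.π i) ≡ i
    π′∘π i = ~-direction (F.line-~ i lo≢hi) (proj₁ (subst₂ (_~[ B.π (F.π i) ]_) (inv _) (inv _)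
      (B.φ-direction (F.φ-direction (F.line-~ i lo≢hi)))))

    σ′∘σ : ∀ i x → B.σ (F.π i) (F.σ i x) ≡ x
    σ′∘σ i x = begin
      B.σ (F.π i) (F.σ i x)            ≡⟨ B.at-φ (F.φ u) (F.π i) ⟨
      at k (B.φ (F.φ u)) (B.π (F.π i)) ≡⟨ cong₂ (at k) (inv u) (π′∘π i) ⟩
      at k u i                         ≡⟨ at-set _ i x ⟩
      x                                ∎
      where
        open ≡-Reasoning
        u = Directions._[_≔_] n k F.origin i x

  module Rigid (k : ℕ) (x₀ y₀ : Fin n) (red₀ : Red x₀ y₀) (dist : Distinguishing (K n) c)
    (aut aut′ : Automorphism (K n ^ suc k))
    (pres : Preserves (K n ^ suc k) (layerColouring k) aut)
    (pres′ : Preserves (K n ^ suc k) (layerColouring k) aut′)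
    (inv : ∀ u → Automorphism.apply aut′ (Automorphism.apply aut u) ≡ u)
    (inv′ : ∀ u → Automorphism.apply aut (Automorphism.apply aut′ u) ≡ u) where

    private
      module F = Preserving k aut pres x₀ y₀ red₀
      module B = Preserving k aut′ pres′ x₀ y₀ red₀
      module P = Pair k x₀ y₀ red₀ aut aut′ pres pres′ inv
      module P′ = Pair k x₀ y₀ red₀ aut′ aut pres′ pres inv′

    -- The reversed pair yields this with `B.π (F.π i)` as the index of the outer map, which is `i`.
    σ∘σ′ : ∀ i y → F.σ i (B.σ (F.π i) y) ≡ y
    σ∘σ′ i y = subst (λ j → F.σ j (B.σ (F.π i) y) ≡ y) (P.π′∘π i) (P′.σ′∘σ (F.π i) y)

    σ-automorphism : Fin (suc k) → Automorphism (K n)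
    σ-automorphism i = record
      { perm = mk↔ₛ′ (F.σ i) (B.σ (F.π i)) (σ∘σ′ i) (P.σ′∘σ i)
      ; adj  = mk⇔ (_∘ F.σ-injective i) (_∘ cong (F.σ i))
      }

    σ-preserves : ∀ i → Preserves (K n) c (σ-automorphism i)
    σ-preserves i p with c.colour p ≟ red
    ... | yes eq = let q , eq′ = F.σ-red i (p , eq)
                   in trans (colour-cong c refl refl _ q) (trans eq′ (sym eq))
    -- With two colours, keeping red in both directions also keeps the other colour.
    ... | no  ne = two-colours red (ne ∘ λ eq →
            let q , eq′ = F.σ-reflects-red i p (_ , eq)
            in trans (colour-cong c refl refl p q) eq′) ne

    σ-id : ∀ i x → F.σ i x ≡ x
    σ-id i = dist (σ-automorphism i) (σ-preserves i)

  module _ (k : ℕ) (x₀ y₀ : Fin n) (red₀ : Red x₀ y₀) (dist : Distinguishing (K n) c) where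

    layer-distinguishing : Distinguishing (K n ^ suc k) (layerColouring k)
    layer-distinguishing aut pres u = at-ext k λ i → begin
      at k (F.φ u) i       ≡⟨ cong (at k (F.φ u)) (π-id i) ⟨
      at k (F.φ u) (F.π i) ≡⟨ F.at-φ u i ⟩
      F.σ i (at k u i)     ≡⟨ R.σ-id i _ ⟩
      at k u i             ∎
      where
        open ≡-Reasoning
        aut′ = inverse aut
        pres′ = inverse-preserves (layerColouring k) aut pres
        inv : ∀ u → Automorphism.apply aut′ (Automorphism.apply aut u) ≡ u
        inv u = Inverse.inverseʳ (Automorphism.perm aut) refl
        inv′ : ∀ u → Automorphism.apply aut (Automorphism.apply aut′ u) ≡ u
        inv′ u = Inverse.inverseˡ (Automorphism.perm aut) refl

        module F = Preserving k aut pres x₀ y₀ red₀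
        module B = Preserving k aut′ pres′ x₀ y₀ red₀
        module R = Rigid k x₀ y₀ red₀ dist aut aut′ pres pres′ inv inv′
        module R′ = Rigid k x₀ y₀ red₀ dist aut′ aut pres′ pres inv′ inv
        module P = Pair k x₀ y₀ red₀ aut aut′ pres pres′ inv

        π-id : ∀ i → F.π i ≡ i
        -- The inverse permutation is increasing too, so `F.π i ≤ B.π (F.π i) ≡ i`.
        π-id i = Fin.≤-antisym
          (subst (F.π i Fin.≤_) (P.π′∘π i)
            (monotone⇒increasing B.π (B.π-monotone R′.σ-id) (F.π i)))
          (monotone⇒increasing F.π (F.π-monotone R.σ-id) i)

-- Distinguishing 2-colourings of complete graphs

opposite-≢ : (j : Fin 2) → j ≢ opposite j
opposite-≢ zero       ()
opposite-≢ (suc zero) ()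

permute : ∀ {n} → Permutation′ n → Automorphism (K n)
permute π = record
  { perm = π
  ; adj  = mk⇔ (_∘ Injection.injective (↔⇒↣ π)) (_∘ cong (Inverse.to π))
  }

-- The path 0-1-2-3-4-5 with the chord 1-3.
baseColour : Fin 6 → Fin 6 → Fin 2
baseColour x y = lookup (lookup matrix x) y
  where
    ○ ● : Fin 2
    ○ = zero
    ● = suc zero

    matrix : Vec (Vec (Fin 2) 6) 6
    matrix = (○ ∷ ● ∷ ○ ∷ ○ ∷ ○ ∷ ○ ∷ [])
           ∷ (● ∷ ○ ∷ ● ∷ ● ∷ ○ ∷ ○ ∷ [])
           ∷ (○ ∷ ● ∷ ○ ∷ ● ∷ ○ ∷ ○ ∷ [])
           ∷ (○ ∷ ● ∷ ● ∷ ○ ∷ ● ∷ ○ ∷ [])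
           ∷ (○ ∷ ○ ∷ ○ ∷ ● ∷ ○ ∷ ● ∷ [])
           ∷ (○ ∷ ○ ∷ ○ ∷ ○ ∷ ● ∷ ○ ∷ [])
           ∷ []

baseColouring : EdgeColouring (K 6) 2
baseColouring = record
  { colour     = λ {x} {y} _ → baseColour x y
  ; unoriented = λ {x} {y} _ _ → toWitness
      {a? = all? λ x → all? λ y → baseColour x y ≟ baseColour y x} _ x y
  }

private
  infix 4 _⇝_ _⇝?_
  -- What a colour-preserving automorphism guarantees for the image of an edge, stated without the
  -- automorphism so that it can be checked by enumeration.
  _⇝_ : Fin 6 × Fin 6 → Fin 6 × Fin 6 → Set
  (i , j) ⇝ (x , y) = x ≢ y × baseColour x y ≡ baseColour i j

  _⇝?_ : ∀ e e′ → Dec (e ⇝ e′)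
  (i , j) ⇝? (x , y) = ¬? (x ≟ y) ×-dec (baseColour x y ≟ baseColour i j)

-- Premises are interleaved with quantifiers so that the exhaustive search prunes early.
baseColour-rigid :
  ∀ a →
  ∀ b → (# 0 , # 1) ⇝ (a , b) →
  ∀ c → (# 0 , # 2) ⇝ (a , c) → (# 1 , # 2) ⇝ (b , c) →
  ∀ d → (# 0 , # 3) ⇝ (a , d) → (# 1 , # 3) ⇝ (b , d) → (# 2 , # 3) ⇝ (c , d) →
  ∀ e → (# 0 , # 4) ⇝ (a , e) → (# 1 , # 4) ⇝ (b , e) → (# 2 , # 4) ⇝ (c , e) →
        (# 3 , # 4) ⇝ (d , e) →
  ∀ f → (# 0 , # 5) ⇝ (a , f) → (# 1 , # 5) ⇝ (b , f) → (# 2 , # 5) ⇝ (c , f) →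
        (# 3 , # 5) ⇝ (d , f) → (# 4 , # 5) ⇝ (e , f) →
  a ≡ # 0 × b ≡ # 1 × c ≡ # 2 × d ≡ # 3 × e ≡ # 4 × f ≡ # 5
baseColour-rigid = toWitness
  {a? = all? λ a →
        all? λ b → (# 0 , # 1) ⇝? (a , b) →-dec
        all? λ c → (# 0 , # 2) ⇝? (a , c) →-dec (# 1 , # 2) ⇝? (b , c) →-dec
        all? λ d → (# 0 , # 3) ⇝? (a , d) →-dec (# 1 , # 3) ⇝? (b , d) →-dec
                   (# 2 , # 3) ⇝? (c , d) →-dec
        all? λ e → (# 0 , # 4) ⇝? (a , e) →-dec (# 1 , # 4) ⇝? (b , e) →-dec
                   (# 2 , # 4) ⇝? (c , e) →-dec (# 3 , # 4) ⇝? (d , e) →-dec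
        all? λ f → (# 0 , # 5) ⇝? (a , f) →-dec (# 1 , # 5) ⇝? (b , f) →-dec
                   (# 2 , # 5) ⇝? (c , f) →-dec (# 3 , # 5) ⇝? (d , f) →-dec
                   (# 4 , # 5) ⇝? (e , f) →-dec
        (a ≟ # 0) ×-dec (b ≟ # 1) ×-dec (c ≟ # 2) ×-dec (d ≟ # 3) ×-dec (e ≟ # 4) ×-dec (f ≟ # 5)} _

baseColouring-distinguishing : Distinguishing (K 6) baseColouring
baseColouring-distinguishing φ pres = fixes
  where
    open Automorphism φ

    p : ∀ {i j} → i ≢ j → (i , j) ⇝ (apply i , apply j)
    p i≢j = Equivalence.to adj i≢j , pres i≢j

    rigid = baseColour-rigid (apply (# 0)) (apply (# 1)) (p λ ()) (apply (# 2)) (p λ ()) (p λ ())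
      (apply (# 3)) (p λ ()) (p λ ()) (p λ ())
      (apply (# 4)) (p λ ()) (p λ ()) (p λ ()) (p λ ())
      (apply (# 5)) (p λ ()) (p λ ()) (p λ ()) (p λ ()) (p λ ())

    fixes : ∀ v → apply v ≡ v
    fixes zero = proj₁ rigid
    fixes (suc zero) = proj₁ (proj₂ rigid)
    fixes (suc (suc zero)) = proj₁ (proj₂ (proj₂ rigid))
    fixes (suc (suc (suc zero))) = proj₁ (proj₂ (proj₂ (proj₂ rigid)))
    fixes (suc (suc (suc (suc zero)))) = proj₁ (proj₂ (proj₂ (proj₂ (proj₂ rigid))))
    fixes (suc (suc (suc (suc (suc zero))))) = proj₂ (proj₂ (proj₂ (proj₂ (proj₂ rigid))))

-- The invariant under which a new vertex with all its edges of colour `ε` is recognisable among the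
-- old ones.
NoStar : ∀ {n} → EdgeColouring (K n) 2 → Fin 2 → Set
NoStar c ε = ∀ u → ∃ λ v → Σ[ p ∈ u ≢ v ] EdgeColouring.colour c p ≢ ε

baseColouring-noStar : ∀ ε → NoStar baseColouring ε
baseColouring-noStar = toWitness
  {a? = all? λ ε → all? λ u → any? λ v → ¬? (u ≟ v) ×-dec ¬? (baseColour u v ≟ ε)} _

module _ {n : ℕ} (c : EdgeColouring (K n) 2) (ε : Fin 2) where
  private module c = EdgeColouring c

  addStar : EdgeColouring (K (suc n)) 2
  addStar = record { colour = λ {u} {v} → colour u v ; unoriented = λ {u} {v} → unoriented u v }
    where
      colour : ∀ u v → u ≢ v → Fin 2
      colour (suc _) (suc _) p = c.colour (p ∘ cong suc)
      colour _       _       _ = ε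

      unoriented : ∀ u v (p : u ≢ v) (q : v ≢ u) → colour u v p ≡ colour v u q
      unoriented (suc _) (suc _) p q = c.unoriented _ _
      unoriented zero    zero    p q = refl
      unoriented zero    (suc _) p q = refl
      unoriented (suc _) zero    p q = refl

  addStar-noStar : ∀ {ε′} → ε ≢ ε′ → Fin n → NoStar addStar ε′
  addStar-noStar ε≢ε′ x zero    = suc x , (λ ()) , ε≢ε′
  addStar-noStar ε≢ε′ x (suc _) = zero  , (λ ()) , ε≢ε′

  -- The new vertex is the only one with all edges of colour `ε`, hence fixed; what remains is a
  -- permutation of the old vertices that preserves `c`.
  addStar-distinguishing : NoStar c ε → Distinguishing (K n) c → Distinguishing (K (suc n)) addStar
  addStar-distinguishing noStar dist φ pres = fixes
    where
      open Automorphism φ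
      open EdgeColouring addStar using (colour)

      fixes-centre : apply zero ≡ zero
      fixes-centre with apply zero in φ0≡
      ... | zero  = refl
      -- If the centre moved to the old vertex `w`, the edge from `w` to `v` would be the image of
      -- an edge at the centre and have colour `ε`.
      ... | suc w with v , w≢v , ne ← noStar w = contradiction (begin
        c.colour w≢v
          ≡⟨ colour-cong c refl refl w≢v (w≢v ∘ Fin.suc-injective ∘ cong suc) ⟩
        colour {suc w} {suc v} (w≢v ∘ Fin.suc-injective)
          ≡⟨ colour-cong addStar φ0≡ (Inverse.inverseˡ perm refl) (Equivalence.to adj 0≢y)
             (w≢v ∘ Fin.suc-injective) ⟨
        colour (Equivalence.to adj 0≢y)
          ≡⟨ pres 0≢y ⟩
        ε ∎) ne
        where
          open ≡-Reasoning
          y : Fin (suc n)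
          y = Inverse.from perm (suc v)

          0≢y : zero ≢ y
          0≢y 0≡y = w≢v (Fin.suc-injective
            (trans (sym φ0≡) (trans (cong apply 0≡y) (Inverse.inverseˡ perm refl))))

      rest : Permutation′ n
      rest = remove zero perm

      suc-rest : ∀ i → suc (Inverse.to rest i) ≡ apply (suc i)
      suc-rest i = lift₀-remove perm fixes-centre (suc i)

      rest-preserves : Preserves (K n) c (permute rest)
      rest-preserves {i} {j} p = begin
        c.colour to-≢
          ≡⟨ colour-cong c refl refl to-≢ (to-≢ ∘ Fin.suc-injective ∘ cong suc) ⟩
        colour {suc (Inverse.to rest i)} {suc (Inverse.to rest j)} (to-≢ ∘ Fin.suc-injective)
          ≡⟨ colour-cong addStar (suc-rest i) (suc-rest j) (to-≢ ∘ Fin.suc-injective) _ ⟩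
        colour (Equivalence.to adj (p ∘ Fin.suc-injective))
          ≡⟨ pres (p ∘ Fin.suc-injective) ⟩
        colour {suc i} {suc j} (p ∘ Fin.suc-injective)
          ≡⟨ colour-cong c refl refl (p ∘ Fin.suc-injective ∘ cong suc) p ⟩
        c.colour p ∎
        where
          open ≡-Reasoning
          to-≢ : Inverse.to rest i ≢ Inverse.to rest j
          to-≢ = p ∘ Injection.injective (↔⇒↣ rest)

      fixes : ∀ v → apply v ≡ v
      fixes zero    = fixes-centre
      fixes (suc i) = trans (sym (suc-rest i)) (cong suc (dist (permute rest) rest-preserves i))

-- A new vertex joined to the old ones by edges of a single colour ε is the only such vertex, and
-- it destroys all monochromatic stars of the other colour; so the colours ε alternate.
K-distinguishing : ∀ m → Σ[ c ∈ EdgeColouring (K (6 + m)) 2 ]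
                         Distinguishing (K (6 + m)) c × ∃ (NoStar c)
K-distinguishing zero =
  baseColouring , baseColouring-distinguishing , zero , baseColouring-noStar zero
K-distinguishing (suc m) with c , dist , ε , noStar ← K-distinguishing m =
  addStar c ε , addStar-distinguishing c ε noStar dist ,
  opposite ε , addStar-noStar c ε (opposite-≢ ε) zero

-- Fewer than two colours do not suffice

module _ {n : ℕ} {x y : Fin n} (x≢y : x ≢ y) where

  -- A nontrivial automorphism, which every constant colouring admits.
  transpose-first : ∀ k → Automorphism (K n ^ suc k)
  transpose-first zero    = permute (transpose x y)
  transpose-first (suc k) = record
    { perm = transpose x y ×-↔ ↔-id _
    ; adj  = mk⇔
        (λ { (inj₁ (refl , p)) → inj₁ (refl , p)
           ; (inj₂ (p , eq)) → inj₂ (Equivalence.to π.adj p , eq) })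
        (λ { (inj₁ (eq , p)) → inj₁ (Injection.injective (↔⇒↣ (transpose x y)) eq , p)
           ; (inj₂ (p , eq)) → inj₂ (Equivalence.from π.adj p , eq) })
    }
    where
      module π = Automorphism (permute (transpose x y))

  transpose-x : Inverse.to (transpose x y) x ≡ y
  transpose-x rewrite dec-true (x ≟ x) refl = refl

  corner : ∀ k → V (K n ^ suc k)
  corner k = Hamming.build n k λ _ → x

  transpose-first-moves : ∀ k → Automorphism.apply (transpose-first k) (corner k) ≢ corner k
  transpose-first-moves zero    eq = x≢y (trans (sym eq) transpose-x)
  transpose-first-moves (suc k) eq = x≢y (trans (sym (cong proj₁ eq)) transpose-x)

  first-edge : ∀ k → ∃₂ (Graph._~_ (K n ^ suc k))
  first-edge zero    = x , y , x≢y
  first-edge (suc k) = (x , corner k) , (y , corner k) , inj₂ (x≢y , refl)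

  constant⇒¬distinguishing : ∀ k {r} (c : EdgeColouring (K n ^ suc k) r) (i : Fin r) →
    (∀ {u v} (p : Graph._~_ (K n ^ suc k) u v) → EdgeColouring.colour c p ≡ i) →
    ¬ Distinguishing (K n ^ suc k) c
  constant⇒¬distinguishing k c i const dist = transpose-first-moves k
    (dist (transpose-first k) (λ p → trans (const _) (sym (const p))) (corner k))

  distinguishing⇒2≤ : ∀ k {r} →
    (Σ[ c ∈ EdgeColouring (K n ^ suc k) r ] Distinguishing (K n ^ suc k) c) → 2 ≤ r
  -- Without colours, the edge `first-edge k` has no colour to take.
  distinguishing⇒2≤ k {zero} (c , _) with () ← EdgeColouring.colour c (proj₂ (proj₂ (first-edge k)))
  distinguishing⇒2≤ k {suc zero} (c , dist) = contradiction dist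
    (constant⇒¬distinguishing k c zero λ p → unique (EdgeColouring.colour c p))
    where
      unique : (i : Fin 1) → i ≡ zero
      unique zero = refl
  distinguishing⇒2≤ k {suc (suc r)} _ = s≤s (s≤s z≤n)

  -- A missing colour would make the colouring constant. This yields the red edge that marks each
  -- distinguished line.
  distinguishing⇒surjective : (c : EdgeColouring (K n) 2) → Distinguishing (K n) c →
    ∀ i → ∃₂ λ u v → Σ[ p ∈ u ≢ v ] EdgeColouring.colour c p ≡ i
  distinguishing⇒surjective c dist i with any? (λ u → any? (λ v → coloured? u v))
    where
      coloured? : ∀ u v → Dec (Σ[ p ∈ u ≢ v ] EdgeColouring.colour c p ≡ i)
      coloured? u v with u ≟ v
      ... | yes u≡v = no λ (p , _) → p u≡v
      ... | no  u≢v with EdgeColouring.colour c u≢v ≟ i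
      ...   | yes eq = yes (u≢v , eq)
      ...   | no  ne = no λ (p , eq) → ne (trans (colour-cong c refl refl u≢v p) eq)
  ... | yes (u , v , r) = u , v , r
  ... | no  none = contradiction dist (constant⇒¬distinguishing 0 c (opposite i) λ p →
          two-colours i (λ eq → none (_ , _ , p , eq)) (≢-sym (opposite-≢ i)))

-- Existence of least costs

-- Search below growing bounds: the first success is least because all smaller values have failed.
least : ∀ {P : Pred ℕ _} → Decidable P → ∀ {m} → P m → ∃ (IsLeast P)
least {P} P? {m} Pm with search (suc m)
  where
    search : ∀ b → ∃ (IsLeast P) ⊎ (∀ {j} → j < b → ¬ P j)
    search zero    = inj₂ λ ()
    search (suc b) with search b
    ... | inj₁ found = inj₁ found
    ... | inj₂ none with P? b
    ...   | yes Pb = inj₁ (b , Pb , λ Pj → ℕ.≮⇒≥ λ j<b → none j<b Pj)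
    ...   | no ¬Pb = inj₂ λ j<1+b Pj → case ℕ.m≤n⇒m<n∨m≡n (ℕ.≤-pred j<1+b) of λ where
            (inj₁ j<b)  → none j<b Pj
            (inj₂ refl) → ¬Pb Pj
... | inj₁ found = found
... | inj₂ none  = contradiction Pm (none ℕ.≤-refl)

-- Exhaustive search over automorphisms and colourings

module Decide (G : Graph) where
  open Graph G using (order; enum; index; _~_; _~?_; ~-sym)

  at-index : Fin order → V G
  at-index = Inverse.from enum

  at-index-index : ∀ v → at-index (index v) ≡ v
  at-index-index v = Inverse.inverseʳ enum refl

  allV? : ∀ {P : V G → Set} → Decidable P → Dec (∀ v → P v)
  allV? {P} P? = map′ (λ f v → subst P (at-index-index v) (f (index v))) (λ f i → f (at-index i))
                   (all? (P? ∘ at-index))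

  -- Vertex maps are numbered so that quantifiers over them range over a `Fin`; codes recover maps
  -- up to pointwise equality.
  decode : Fin (order ℕ.^ order) → V G → V G
  decode a v = at-index (finToFun a (index v))

  encode : (V G → V G) → Fin (order ℕ.^ order)
  encode f = funToFin (index ∘ f ∘ at-index)

  decode-encode : ∀ f v → decode (encode f) v ≡ f v
  decode-encode f v = begin
    at-index (finToFun (encode f) (index v))
      ≡⟨ cong at-index (Fin.finToFun-funToFin _ (index v)) ⟩
    at-index (index (f (at-index (index v)))) ≡⟨ at-index-index _ ⟩
    f (at-index (index v))                    ≡⟨ cong f (at-index-index v) ⟩
    f v                                       ∎
    where open ≡-Reasoning

  module _ {r : ℕ} (c : EdgeColouring G r) where
    open EdgeColouring c

    SameEdge : V G → V G → V G → V G → Set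
    SameEdge u v u′ v′ = (u ~ v → u′ ~ v′) × (u′ ~ v′ → u ~ v) ×
                         (∀ (p : u ~ v) (q : u′ ~ v′) → colour q ≡ colour p)

    sameEdge? : ∀ u v u′ v′ → Dec (SameEdge u v u′ v′)
    sameEdge? u v u′ v′ = ((u ~? v) →-dec (u′ ~? v′)) ×-dec ((u′ ~? v′) →-dec (u ~? v)) ×-dec same?
      where
        same? : Dec (∀ (p : u ~ v) (q : u′ ~ v′) → colour q ≡ colour p)
        same? with u ~? v | u′ ~? v′
        ... | no ¬p | _     = yes λ p → contradiction p ¬p
        ... | yes _ | no ¬q = yes λ _ q → contradiction q ¬q
        ... | yes p | yes q = map′
                (λ eq p′ q′ → trans (colour-cong c refl refl q′ q)
                                (trans eq (colour-cong c refl refl p p′)))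
                (λ same → same p q) (colour q ≟ colour p)

    -- A colour-preserving automorphism with its inverse, as conditions on two bare maps, each
    -- decidable by a search over vertices.
    Symmetry : (V G → V G) → (V G → V G) → Set
    Symmetry f g = (∀ v → f (g v) ≡ v) × (∀ v → g (f v) ≡ v) ×
                   (∀ u v → SameEdge u v (f u) (f v))

    symmetry? : ∀ f g → Dec (Symmetry f g)
    symmetry? f g =
      allV? (λ v → Graph._≟_ G (f (g v)) v) ×-dec allV? (λ v → Graph._≟_ G (g (f v)) v) ×-dec
      allV? (λ u → allV? λ v → sameEdge? u v (f u) (f v))

    distinguishing? : Dec (Distinguishing G c)
    distinguishing? = map′ forwards backwards
      (all? λ a → all? λ b → symmetry? (decode a) (decode b) →-dec
        allV? λ v → Graph._≟_ G (decode a v) v)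
      where
        Rigid : Set
        Rigid = ∀ a b → Symmetry (decode a) (decode b) → ∀ v → decode a v ≡ v

        forwards : Rigid → Distinguishing G c
        forwards rigid φ pres v = trans (sym (f≗ v)) (rigid (encode apply) (encode from)
          ( (λ v → trans (f≗ _) (trans (cong apply (g≗ v)) (Inverse.inverseˡ perm refl)))
          , (λ v → trans (g≗ _) (trans (cong from (f≗ v)) (Inverse.inverseʳ perm refl)))
          , λ u v → (λ p → subst₂ _~_ (sym (f≗ u)) (sym (f≗ v)) (Equivalence.to adj p))
                  , (λ q → Equivalence.from adj (subst₂ _~_ (f≗ u) (f≗ v) q))
                  , λ p q → trans (colour-cong c (f≗ u) (f≗ v) q _) (pres p)) v)
          where
            open Automorphism φ
            from = Inverse.from perm
            f≗ = decode-encode apply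
            g≗ = decode-encode from

        backwards : Distinguishing G c → Rigid
        backwards dist a b (fg , gf , same) = dist
          (record { perm = mk↔ₛ′ (decode a) (decode b) fg gf
                  ; adj  = mk⇔ (proj₁ (same _ _)) (proj₁ (proj₂ (same _ _))) })
          (λ p → proj₂ (proj₂ (same _ _)) p _)

  module _ {r : ℕ} {c c′ : EdgeColouring G r}
    (c≗c′ : ∀ {u v} (p : u ~ v) → EdgeColouring.colour c p ≡ EdgeColouring.colour c′ p) where

    -- A colouring and its decoded copy agree only edge by edge, so the properties that enter the
    -- cost are transported along such agreement.
    distinguishing-cong : Distinguishing G c → Distinguishing G c′
    distinguishing-cong dist φ pres =
      dist φ λ p → trans (c≗c′ _) (trans (pres p) (sym (c≗c′ p)))

    length-colourClass-cong : ∀ i → length (colourClass G c i) ≡ length (colourClass G c′ i)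
    length-colourClass-cong i = cong length (filter-≐ (represents? G c i) (represents? G c′ i)
      ( (λ (lt , p , eq) → lt , p , trans (sym (c≗c′ p)) eq)
      , (λ (lt , p , eq) → lt , p , trans (c≗c′ p) eq))
      (cartesianProduct (Graph.vertices G) (Graph.vertices G)))

  -- Combining the entries for (u , v) and (v , u) makes every table a colouring, and leaves the
  -- table of a colouring unchanged.
  meet : Fin 2 → Fin 2 → Fin 2
  meet zero    _ = zero
  meet (suc _) j = j

  meet-comm : ∀ i j → meet i j ≡ meet j i
  meet-comm zero       zero       = refl
  meet-comm zero       (suc zero) = refl
  meet-comm (suc zero) zero       = refl
  meet-comm (suc zero) (suc zero) = refl

  meet-idem : ∀ i → meet i i ≡ i
  meet-idem zero    = refl
  meet-idem (suc _) = refl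

  tableColouring : (Fin (order * order) → Fin 2) → EdgeColouring G 2
  tableColouring t = record
    { colour     = λ {u} {v} _ → meet (entry u v) (entry v u)
    ; unoriented = λ {u} {v} _ _ → meet-comm (entry u v) (entry v u)
    }
    where
      entry : V G → V G → Fin 2
      entry u v = t (combine (index u) (index v))

  codeColouring : Fin (2 ℕ.^ (order * order)) → EdgeColouring G 2
  codeColouring a = tableColouring (finToFun a)

  module _ (c : EdgeColouring G 2) where
    open EdgeColouring c

    entry : V G → V G → Fin 2
    entry u v with u ~? v
    ... | yes p = colour p
    -- An arbitrary default: the colouring built from the table reads only entries of adjacent
    -- pairs.
    ... | no  _ = zero

    entry-colour : ∀ {u v} (p : u ~ v) → entry u v ≡ colour p
    entry-colour {u} {v} p with u ~? v
    ... | yes q = colour-cong c refl refl q p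
    ... | no ¬p = contradiction p ¬p

    table : Fin (order * order) → Fin 2
    table i = let x , y = Fin.remQuot {order} order i in entry (at-index x) (at-index y)

    table-combine : ∀ u v → finToFun (funToFin table) (combine (index u) (index v)) ≡ entry u v
    table-combine u v = begin
      finToFun (funToFin table) (combine (index u) (index v)) ≡⟨ Fin.finToFun-funToFin table _ ⟩
      table (combine (index u) (index v))
        ≡⟨ cong (λ (x , y) → entry (at-index x) (at-index y))
             (Fin.remQuot-combine (index u) (index v)) ⟩
      entry (at-index (index u)) (at-index (index v))
        ≡⟨ cong₂ entry (at-index-index u) (at-index-index v) ⟩
      entry u v ∎
      where open ≡-Reasoning

    codeColouring-surjective : ∀ {u v} (p : u ~ v) →
      colour p ≡ EdgeColouring.colour (codeColouring (funToFin table)) p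
    codeColouring-surjective {u} {v} p = begin
      colour p                     ≡⟨ meet-idem (colour p) ⟨
      meet (colour p) (colour p)   ≡⟨ cong (meet (colour p)) (unoriented p (~-sym p)) ⟩
      meet (colour p) (colour (~-sym p))
        ≡⟨ cong₂ meet (entry-colour p) (entry-colour (~-sym p)) ⟨
      meet (entry u v) (entry v u) ≡⟨ cong₂ meet (table-combine u v) (table-combine v u) ⟨
      meet (finToFun (funToFin table) (combine (index u) (index v)))
           (finToFun (funToFin table) (combine (index v) (index u))) ∎
      where open ≡-Reasoning

  Cost : Pred ℕ _
  Cost s = Σ[ c ∈ EdgeColouring G 2 ] (Distinguishing G c × smallerClass G c ≡ s)

  cost? : Decidable Cost
  cost? s = map′ (λ (a , p) → codeColouring a , p) encoded
    (any? λ a → distinguishing? (codeColouring a) ×-dec (smallerClass G (codeColouring a) ℕ.≟ s))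
    where
      encoded : Cost s → ∃ λ a → Distinguishing G (codeColouring a) ×
                                 smallerClass G (codeColouring a) ≡ s
      encoded (c , dist , eq) = funToFin (table c)
        , distinguishing-cong {c = c} {c′} (codeColouring-surjective c) dist
        , trans (sym (cong₂ _⊓_ (same zero) (same (suc zero)))) eq
        where
          c′ : EdgeColouring G 2
          c′ = codeColouring (funToFin (table c))

          same : ∀ i → length (colourClass G c i) ≡ length (colourClass G c′ i)
          same = length-colourClass-cong {c = c} {c′} (codeColouring-surjective c)

  leastCost : (c : EdgeColouring G 2) → Distinguishing G c →
              ∃ λ m → IsLeast Cost m × m ≤ smallerClass G c
  leastCost c dist = m , m-least , proj₂ m-least cost
    where
      cost : Cost (smallerClass G c)
      cost = c , dist , refl

      m : ℕ
      m = proj₁ (least cost? cost)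

      m-least : IsLeast Cost m
      m-least = proj₂ (least cost? cost)

-- The cost of the powers

ρ′-exists : ∀ {n} {x y : Fin n} → x ≢ y → ∀ k (c : EdgeColouring (K n ^ suc k) 2) →
            Distinguishing (K n ^ suc k) c →
            ∃ λ b → (ρ′[ K n ^ suc k ]≡ b) × b ≤ smallerClass (K n ^ suc k) c
ρ′-exists {n} x≢y k c dist =
  let b , b-least , b≤ = Decide.leastCost (K n ^ suc k) c dist
  in b , (((c , dist) , distinguishing⇒2≤ x≢y k) , b-least) , b≤

minority : ∀ G c → ∃ λ i → length (colourClass G c i) ≡ smallerClass G c
minority G c with ℕ.⊓-sel (length (colourClass G c zero)) (length (colourClass G c (suc zero)))
... | inj₁ eq = zero , sym eq
... | inj₂ eq = suc zero , sym eq

smallerClass-≤ : ∀ G c i → smallerClass G c ≤ length (colourClass G c i)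
smallerClass-≤ G c zero       = ℕ.m⊓n≤m _ _
smallerClass-≤ G c (suc zero) = ℕ.m⊓n≤n _ _

-- The layer colouring is built from an optimal colouring of `K n`, with its smaller class as red.
-- The least cost of the power is at most the size of the red class there.
power-cost : ∀ {n} (lo hi : Fin n) → lo ≢ hi → ∀ k {a} → ρ′[ K n ]≡ a →
             ∃ λ b → (ρ′[ K n ^ suc k ]≡ b) × b ≤ suc k * a
power-cost {n} lo hi lo≢hi k (_ , (c , dist , refl) , _) = proj₁ ρ′ , proj₁ (proj₂ ρ′) , (begin
  proj₁ ρ′                                   ≤⟨ proj₂ (proj₂ ρ′) ⟩
  smallerClass (K n ^ suc k) (layerColouring k)
    ≤⟨ smallerClass-≤ (K n ^ suc k) (layerColouring k) red ⟩
  length (colourClass (K n ^ suc k) (layerColouring k) red) ≤⟨ length-layerClass k ⟩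
  suc k * length (colourClass (K n) c red)   ≡⟨ cong (suc k *_) (proj₂ (minority (K n) c)) ⟩
  suc k * smallerClass (K n) c               ∎)
  where
    open ℕ.≤-Reasoning
    red : Fin 2
    red = proj₁ (minority (K n) c)

    open LayerColouring n lo hi lo≢hi c red (opposite red) (opposite-≢ red)

    ρ′ : ∃ λ b → (ρ′[ K n ^ suc k ]≡ b) × b ≤ smallerClass (K n ^ suc k) (layerColouring k)
    ρ′ with x , y , red₀ ← distinguishing⇒surjective lo≢hi c dist red =
      ρ′-exists lo≢hi k (layerColouring k) (layer-distinguishing k x y red₀ dist)

ρ′-power : ∀ {n} (lo hi : Fin n) → lo ≢ hi →
           (Σ[ c ∈ EdgeColouring (K n) 2 ] Distinguishing (K n) c) → ∀ k →
           ∃₂ λ a b → (ρ′[ K n ]≡ a) × (ρ′[ K n ^ suc k ]≡ b) × b ≤ suc k * a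
ρ′-power lo hi lo≢hi (c , dist) k =
  let a , ρ′a , _  = ρ′-exists lo≢hi 0 c dist
      b , ρ′b , b≤ = power-cost lo hi lo≢hi k ρ′a
  in a , b , ρ′a , ρ′b , b≤

theorem5p14 : (n k : ℕ) .{{_ : NonZero k}} → 6 ≤ n → k ≤ n + 1 →
    ∃₂ λ a b → (ρ′[ K n ]≡ a) × (ρ′[ K n ^ k ]≡ b) × b ≤ k * a
theorem5p14 n zero {{k≢0}} _ _ = contradiction (ℕ.>-nonZero⁻¹ zero {{k≢0}}) λ ()
theorem5p14 n (suc k) 6≤n _ = from-6+ (proj₁ m+6≡n) (proj₂ m+6≡n)
  where
    m+6≡n : ∃ λ m → 6 + m ≡ n
    m+6≡n = ℕ.m≤n⇒∃[o]m+o≡n 6≤n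

    -- Generalised over `n` so that the equation can be matched with `refl`.
    from-6+ : ∀ {n} m → 6 + m ≡ n →
              ∃₂ λ a b → (ρ′[ K n ]≡ a) × (ρ′[ K n ^ suc k ]≡ b) × b ≤ suc k * a
    from-6+ m refl = let c , dist , _ = K-distinguishing m
                     in ρ′-power zero (suc zero) (λ ()) (c , dist) k
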